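{- The performance guarantee of the algorithm $2$-Exchange for the minimum SCSS problem is $1.75$. That is, for every strongly connected digraph $G$, every edge set that $2$-Exchange can return on input $G$ has at most $1.75\cdot\mathcal{OPT}(G)$ edges, and the constant $1.75$ cannot be replaced by any smaller constant.
   Context: Digraphs are finite, without self-loops or parallel edges. An SCSS (strongly connected spanning subgraph) of a strongly connected digraph $G=(V,E)$ is a subset of $E$ that strongly connects $V$; $\mathcal{OPT}(G)$ is the minimum number of edges in an SCSS of $G$. The minimum SCSS problem asks for an SCSS with $\mathcal{OPT}(G)$ edges. Algorithm $2$-Exchange on $G=(V,E)$: start with $E'=E$. While possible, perform the following improvement step: pick a set $E_2$ of $2$ edges in $E'$ and a set $E_1$ of at most one edge in $E$ such that $E''=(E'\setminus E_2)\cup E_1$ is an SCSS of $G$ (any such choice is allowed), and replace $E'$ by $E''$. When no such step is possible, return $E'$. -}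

module Defs where

open import Data.Nat using (ℕ; _≤_)
open import Data.Fin using (Fin)
open import Data.Fin.Subset using (Subset; _∈_; _⊆_; _∪_; _─_; ⊤; ∣_∣)
open import Data.Integer using (+_)
import Data.Rational as ℚ
open ℚ using (ℚ)
open import Data.Product using (_×_; ∃-syntax)
open import Relation.Nullary using (¬_)
open import Relation.Binary.PropositionalEquality using (_≡_; _≢_)
open import Relation.Binary.Construct.Closure.ReflexiveTransitive using (Star)

-- Vertices and edges are both numbered, so that a set of edges is a
-- `Subset #E`, the full edge set E is `⊤`, and cardinality is `∣_∣`.
record Digraph : Set where
  field
    #V          : ℕ
    #E          : ℕ
    src tgt     : Fin #E → Fin #V
    no-loop     : ∀ e → src e ≢ tgt e
    no-parallel : ∀ e f → src e ≡ src f → tgt e ≡ tgt f → e ≡ f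

module _ (G : Digraph) where
  open Digraph G

  EdgeSet : Set
  EdgeSet = Subset #E

  Arc : EdgeSet → Fin #V → Fin #V → Set
  Arc S u v = ∃[ e ] (e ∈ S × src e ≡ u × tgt e ≡ v)

  SCSS : EdgeSet → Set
  SCSS S = ∀ u v → Star (Arc S) u v

  StronglyConnected : Set
  StronglyConnected = SCSS ⊤

  -- k = 𝒪𝒫𝒯(G).
  IsOPT : ℕ → Set
  IsOPT k = (∃[ S ] (SCSS S × ∣ S ∣ ≡ k)) × (∀ S → SCSS S → k ≤ ∣ S ∣)

  -- E₁ is not required to be disjoint from E′, nor from E₂; with E₁
  -- a singleton inside E₂, the step deletes a single edge.
  Step : EdgeSet → EdgeSet → Set
  Step E′ E″ = ∃[ E₂ ] ∃[ E₁ ]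
    ( E₂ ⊆ E′ × ∣ E₂ ∣ ≡ 2 × ∣ E₁ ∣ ≤ 1
    × E″ ≡ (E′ ─ E₂) ∪ E₁ × SCSS E″ )

  -- The algorithm is nondeterministic: these are its possible outputs.
  2-Exchange-Returns : EdgeSet → Set
  2-Exchange-Returns E′ = Star Step ⊤ E′ × (∀ E″ → ¬ Step E′ E″)

fromℕ : ℕ → ℚ
fromℕ n = + n ℚ./ 1

2-Exchange-Ratio≤ : ℚ → Set
2-Exchange-Ratio≤ c =
  ∀ (G : Digraph) → StronglyConnected G →
  ∀ (E′ : EdgeSet G) → 2-Exchange-Returns G E′ →
  ∀ (k : ℕ) → IsOPT G k → fromℕ ∣ E′ ∣ ℚ.≤ c ℚ.* fromℕ k

{-# OPTIONS --safe #-}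
module Submission where

-- Upper bound.  Contract cycles of length at least 3 of the locally
-- optimal E′ as long as there are any, then the remaining 2-cycles.  If
-- the first phase stops at c classes, it has used at most 3(n - c)/2
-- edges, and the second uses exactly 2(c - 1); by minimality these are
-- all the edges of E′.  After the first phase E′ is a tree of 2-cycles
-- between the classes, and G has no edge between two classes that are not
-- adjacent in that tree: together with such an edge, a path of E′ between
-- its ends would allow an exchange of two edges for one.  Hence every SCSS
-- uses both directions of every tree edge and has at least 2(c - 1) edges,
-- besides having at least n.
--
-- Tightness.  Let E′ consist of t directed triangles with a common vertex
-- and a leaf attached by a 2-cycle to each of the 2t + 1 hubs, 7t + 2 edges
-- on 4t + 2 vertices.  G adds to E′ a Hamiltonian cycle alternating between
-- hubs and leaves.  Around every triangle no edge of the cycle leads to the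
-- next corner, so adding one does not make any triangle edge redundant.

open import Defs
open import Data.Bool as Bool using (Bool; true; false; not)
open import Data.Fin as Fin using (Fin; zero; suc; inject₁; punchOut; _↑ˡ_; _↑ʳ_)
open import Data.Fin.Induction using (<-weakInduction; >-weakInduction)
import Data.Fin.Properties as Fin
open import Data.Fin.Subset using (Subset; Nonempty; _∈_; _∉_; _⊆_; _∪_; _─_; _-_; ⊥; ⊤; ⁅_⁆; ⋃; ∣_∣)
open import Data.Fin.Subset.Properties
open import Data.Integer as ℤ using (+_)
import Data.Integer.Properties as ℤ
import Data.Integer.Tactic.RingSolver as ℤ
open import Data.List using (List; []; _∷_; _++_; length; map)
import Data.List.Membership.DecPropositional as DecMembership
open import Data.List.Membership.Propositional using () renaming (_∈_ to _∈ˡ_)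
open import Data.List.Membership.Propositional.Properties using (∈-++⁺ˡ; ∈-++⁺ʳ)
open import Data.List.Properties using (length-++; length-tabulate)
open import Data.List.Relation.Unary.All as All using (All; []; _∷_)
import Data.List.Relation.Unary.All.Properties as All
open import Data.List.Relation.Unary.AllPairs using ([]; _∷_)
open import Data.List.Relation.Unary.Any using (here; there)
open import Data.List.Relation.Unary.Unique.Propositional using (Unique)
open import Data.List.Relation.Unary.Unique.Propositional.Properties using (tabulate⁺)
open import Data.Nat as ℕ using (ℕ; zero; suc; _≤_; z≤n; s≤s)
open import Data.Nat.Induction using (<-wellFounded)
import Data.Nat.Properties as ℕ
open import Data.Nat.Tactic.RingSolver using (solve-∀)
open import Data.Product using (∃-syntax; _×_; _,_; proj₁; proj₂)
open import Data.Product.Function.NonDependent.Propositional using (_×-↔_)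
open import Data.Product.Properties using (≡-dec)
open import Data.Rational as ℚ using (ℚ; _/_; _<_; ↥_; ↧_; ↧ₙ_; toℚᵘ)
import Data.Rational.Properties as ℚ
open import Data.Rational.Unnormalised as ℚᵘ using (mkℚᵘ; *≤*)
import Data.Rational.Unnormalised.Properties as ℚᵘ
open import Data.Sum as Sum using (_⊎_; inj₁; inj₂; [_,_]′)
open import Data.Sum.Function.Propositional using (_⊎-↔_)
import Data.Sum.Properties as Sum
open import Data.Unit using (tt) renaming (⊤ to Unit)
open import Data.Vec as Vec using ([]; _∷_) renaming (_++_ to _++ᵛ_)
import Data.Vec.Properties as Vec
open import Function using (_∘_; id; _↔_; Inverse; Injection)
open import Function.Construct.Composition using (_↔-∘_)
open import Function.Properties.Inverse using (↔⇒↣; ↔-sym)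
open import Induction.WellFounded using (Acc; acc)
open import Level using (0ℓ)
open import Relation.Binary using (Rel; DecidableEquality)
open import Relation.Binary.Construct.Closure.ReflexiveTransitive as Star using (Star; ε; _◅_; _◅◅_; _⋆)
open import Relation.Binary.PropositionalEquality
open import Relation.Nullary using (¬_; Dec; yes; no; contradiction)
open import Relation.Nullary.Decidable using (_×-dec_; ¬?; decidable-stable)
open import Relation.Unary using (Decidable)

private variable
  n : ℕ

-- Cardinalities of finite sets.

∣p∪q∣≤∣p∣+∣q∣ : ∀ (p q : Subset n) → ∣ p ∪ q ∣ ≤ ∣ p ∣ ℕ.+ ∣ q ∣
∣p∪q∣≤∣p∣+∣q∣ []          []          = z≤n
∣p∪q∣≤∣p∣+∣q∣ (false ∷ p) (false ∷ q) = ∣p∪q∣≤∣p∣+∣q∣ p q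
∣p∪q∣≤∣p∣+∣q∣ (false ∷ p) (true  ∷ q) =
  ℕ.≤-trans (s≤s (∣p∪q∣≤∣p∣+∣q∣ p q)) (ℕ.≤-reflexive (sym (ℕ.+-suc ∣ p ∣ ∣ q ∣)))
∣p∪q∣≤∣p∣+∣q∣ (true  ∷ p) (false ∷ q) = s≤s (∣p∪q∣≤∣p∣+∣q∣ p q)
∣p∪q∣≤∣p∣+∣q∣ (true  ∷ p) (true  ∷ q) =
  s≤s (ℕ.≤-trans (∣p∪q∣≤∣p∣+∣q∣ p q) (ℕ.+-monoʳ-≤ ∣ p ∣ (ℕ.n≤1+n ∣ q ∣)))

∣⁅x⁆∪p∣≤1+∣p∣ : ∀ (x : Fin n) (p : Subset n) → ∣ ⁅ x ⁆ ∪ p ∣ ≤ suc ∣ p ∣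
∣⁅x⁆∪p∣≤1+∣p∣ x p =
  ℕ.≤-trans (∣p∪q∣≤∣p∣+∣q∣ ⁅ x ⁆ p) (ℕ.≤-reflexive (cong (ℕ._+ ∣ p ∣) (∣⁅x⁆∣≡1 x)))

length≤∣p∣ : ∀ {xs : List (Fin n)} {p} → Unique xs → All (_∈ p) xs → length xs ≤ ∣ p ∣
length≤∣p∣ []         []         = z≤n
length≤∣p∣ (x∉xs ∷ u) (x∈p ∷ ps) = ℕ.≤-trans
  (s≤s (length≤∣p∣ u (All.zipWith (λ (x≢y , y∈p) → x∈p∧x≢y⇒x∈p-y y∈p (x≢y ∘ sym)) (x∉xs , ps))))
  (x∈p⇒∣p-x∣<∣p∣ x∈p)

∣p∣≤length : ∀ {xs : List (Fin n)} {p} → (∀ {x} → x ∈ p → x ∈ˡ xs) → ∣ p ∣ ≤ length xs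
∣p∣≤length {n = n} {xs} p⊆xs = ℕ.≤-trans (p⊆q⇒∣p∣≤∣q∣ (∈-⋃ xs ∘ p⊆xs)) (∣⋃∣≤ xs)
  where
  ∈-⋃ : ∀ (ys : List (Fin n)) {x} → x ∈ˡ ys → x ∈ ⋃ (map ⁅_⁆ ys)
  ∈-⋃ (y ∷ ys) (here refl) = x∈p∪q⁺ (inj₁ (x∈⁅x⁆ y))
  ∈-⋃ (y ∷ ys) (there x∈)  = x∈p∪q⁺ (inj₂ (∈-⋃ ys x∈))

  ∣⋃∣≤ : ∀ (ys : List (Fin n)) → ∣ ⋃ (map ⁅_⁆ ys) ∣ ≤ length ys
  ∣⋃∣≤ []       = ℕ.≤-reflexive (∣⊥∣≡0 n)
  ∣⋃∣≤ (y ∷ ys) = ℕ.≤-trans (∣⁅x⁆∪p∣≤1+∣p∣ y _) (s≤s (∣⋃∣≤ ys))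

∣⁅x⁆∪⁅y⁆∣≡2 : ∀ {x y : Fin n} → x ≢ y → ∣ ⁅ x ⁆ ∪ ⁅ y ⁆ ∣ ≡ 2
∣⁅x⁆∪⁅y⁆∣≡2 {x = x} {y} x≢y = ℕ.≤-antisym
  (ℕ.≤-trans (∣⁅x⁆∪p∣≤1+∣p∣ x ⁅ y ⁆) (ℕ.≤-reflexive (cong suc (∣⁅x⁆∣≡1 y))))
  (length≤∣p∣ ((x≢y ∷ []) ∷ [] ∷ [])
    (x∈p∪q⁺ (inj₁ (x∈⁅x⁆ x)) ∷ x∈p∪q⁺ {p = ⁅ x ⁆} (inj₂ (x∈⁅x⁆ y)) ∷ []))

x∈p─q⇒x∉q : ∀ (p q : Subset n) {x} → x ∈ p ─ q → x ∉ q
x∈p─q⇒x∉q (_ ∷ p) (_ ∷ q) (Vec.there x∈) (Vec.there x∈q) = x∈p─q⇒x∉q p q x∈ x∈q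

another∈ : ∀ {p : Subset n} → 2 ≤ ∣ p ∣ → ∀ y → ∃[ x ] (x ∈ p × x ≢ y)
another∈ {p = p} 2≤∣p∣ y with nonempty? (p - y)
... | yes (x , x∈p-y) = x , p─q⊆p p ⁅ y ⁆ x∈p-y , λ { refl → x∈p─q⇒x∉q p ⁅ y ⁆ x∈p-y (x∈⁅x⁆ y) }
... | no  p-y-empty = contradiction (ℕ.≤-trans 2≤∣p∣ ∣p∣≤1) λ { (s≤s ()) }
  where
  x≡y : ∀ {x} → x ∈ p → x ≡ y
  x≡y {x} x∈p with x Fin.≟ y
  ... | yes eq = eq
  ... | no neq = contradiction (x , x∈p∧x≢y⇒x∈p-y x∈p neq) p-y-empty
  ∣p∣≤1 : ∣ p ∣ ≤ 1
  ∣p∣≤1 = ∣p∣≤length {xs = y ∷ []} (here ∘ x≡y)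

∣p∣≤1⇒≡ : ∀ {p : Subset n} → ∣ p ∣ ≤ 1 → ∀ {x y} → x ∈ p → y ∈ p → x ≡ y
∣p∣≤1⇒≡ ∣p∣≤1 {x} {y} x∈p y∈p with x Fin.≟ y
... | yes x≡y = x≡y
... | no  x≢y = contradiction
  (ℕ.≤-trans (length≤∣p∣ ((x≢y ∷ []) ∷ [] ∷ []) (x∈p ∷ y∈p ∷ [])) ∣p∣≤1) λ { (s≤s ()) }

-- Simple paths.

-- The list holds the vertices of the path except the first, so its
-- length is the number of arcs.
data SimplePath {I : Set} (R : Rel I 0ℓ) : I → I → List I → Set where
  []     : ∀ {i} → SimplePath R i i []
  _∷_by_ : ∀ {i j k xs} → R i j → SimplePath R j k xs → All (i ≢_) (j ∷ xs) →
           SimplePath R i k (j ∷ xs)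

module _ {I : Set} {R : Rel I 0ℓ} where

  vertices-unique : ∀ {i k xs} → SimplePath R i k xs → Unique (i ∷ xs)
  vertices-unique []            = [] ∷ []
  vertices-unique (r ∷ p by i∉) = i∉ ∷ vertices-unique p

  suffixFrom : ∀ {j k xs} → SimplePath R j k xs → ∀ {i} → i ∈ˡ j ∷ xs → ∃[ ys ] SimplePath R i k ys
  suffixFrom p            (here refl) = _ , p
  suffixFrom (r ∷ p by _) (there i∈)  = suffixFrom p i∈

  mapPath : ∀ {R′ : Rel I 0ℓ} → (∀ {i j} → R i j → R′ i j) →
            ∀ {i k xs} → SimplePath R i k xs → SimplePath R′ i k xs
  mapPath f []            = []
  mapPath f (r ∷ p by i∉) = f r ∷ mapPath f p by i∉

simplify : ∀ {R : Rel (Fin n) 0ℓ} {i k} → Star R i k → ∃[ xs ] SimplePath R i k xs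
simplify ε = [] , []
simplify {i = i} (r ◅ w) with simplify w
... | xs , p with DecMembership._∈?_ Fin._≟_ i (_ ∷ xs)
... | yes i∈ = suffixFrom p i∈
... | no  i∉ = _ , r ∷ p by All.¬Any⇒All¬ _ i∉

-- Identifying elements of a finite set.

-- `punchOut` removes `p` from the target, and `p` itself is sent to the place of `q`.
identify : ∀ {c} (p q : Fin (suc c)) → p ≢ q →
           ∃[ ν ] (ν p ≡ ν q × (∀ a b → ν a ≡ ν b → a ≡ b ⊎ ((a ≡ p ⊎ a ≡ q) × (b ≡ p ⊎ b ≡ q))))
identify {c} p q p≢q = ν , νp≡νq , ν-inj
  where
  ν : Fin (suc c) → Fin c
  ν a with p Fin.≟ a
  ... | yes _   = punchOut p≢q
  ... | no  p≢a = punchOut p≢a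

  νp≡νq : ν p ≡ ν q
  νp≡νq with p Fin.≟ p | p Fin.≟ q
  ... | _      | yes p≡q = contradiction p≡q p≢q
  ... | no p≢p | _       = contradiction refl p≢p
  ... | yes _  | no p≢q′ = Fin.punchOut-cong p refl

  ν-inj : ∀ a b → ν a ≡ ν b → a ≡ b ⊎ ((a ≡ p ⊎ a ≡ q) × (b ≡ p ⊎ b ≡ q))
  ν-inj a b eq with p Fin.≟ a | p Fin.≟ b
  ... | yes p≡a | yes p≡b = inj₁ (trans (sym p≡a) p≡b)
  ... | yes p≡a | no  p≢b = inj₂ (inj₁ (sym p≡a) , inj₂ (sym (Fin.punchOut-injective p≢q p≢b eq)))
  ... | no  p≢a | yes p≡b = inj₂ (inj₂ (Fin.punchOut-injective p≢a p≢q eq) , inj₁ (sym p≡b))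
  ... | no  p≢a | no  p≢b = inj₁ (Fin.punchOut-injective p≢a p≢b eq)

Identifies : ∀ {c c′} → (Fin c → Fin c′) → List (Fin c) → Set
Identifies μ xs = (∀ {a b} → a ∈ˡ xs → b ∈ˡ xs → μ a ≡ μ b) ×
                  (∀ {a b} → μ a ≡ μ b → a ≡ b ⊎ (a ∈ˡ xs × b ∈ˡ xs))

-- The tail is merged with `i` first; `j` is then still apart from that class and is glued to it.
-- Each gluing costs one element.
identifyAll : ∀ {c} (i : Fin c) xs → Unique (i ∷ xs) →
              ∃[ c′ ] ∃[ μ ] (c ≡ length xs ℕ.+ c′ × Identifies {c} {c′} μ (i ∷ xs))
identifyAll {c} i [] _ = c , id , refl , (λ { (here refl) (here refl) → refl }) , inj₁
identifyAll i (j ∷ xs) ((i≢j ∷ i∉xs) ∷ j∉xs ∷ u) with identifyAll i xs (i∉xs ∷ u)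
... | zero , μ , _ = contradiction (μ i) Fin.¬Fin0
... | suc c′ , μ , c≡ , μ-glues , μ-sep =
  c′ , ν ∘ μ , trans c≡ (ℕ.+-suc _ c′) , (λ a∈ b∈ → trans (to-i a∈) (sym (to-i b∈))) , sep
  where
  j∉ : ¬ j ∈ˡ i ∷ xs
  j∉ (here j≡i)  = i≢j (sym j≡i)
  j∉ (there j∈)  = All.lookup j∉xs j∈ refl

  μj≢μi : μ j ≢ μ i
  μj≢μi eq = [ i≢j ∘ sym , j∉ ∘ proj₁ ]′ (μ-sep eq)

  glue = identify (μ j) (μ i) μj≢μi
  ν = proj₁ glue

  to-i : ∀ {a} → a ∈ˡ i ∷ j ∷ xs → ν (μ a) ≡ ν (μ i)
  to-i (here refl)         = refl
  to-i (there (here refl)) = proj₁ (proj₂ glue)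
  to-i (there (there a∈))  = cong ν (μ-glues (there a∈) (here refl))

  weaken : ∀ {a} → a ∈ˡ i ∷ xs → a ∈ˡ i ∷ j ∷ xs
  weaken (here eq)  = here eq
  weaken (there a∈) = there (there a∈)

  near : ∀ {a} → μ a ≡ μ j ⊎ μ a ≡ μ i → a ∈ˡ i ∷ j ∷ xs
  near (inj₁ eq) = [ there ∘ here , (λ (_ , j∈) → contradiction j∈ j∉) ]′ (μ-sep eq)
  near (inj₂ eq) = [ here , weaken ∘ proj₁ ]′ (μ-sep eq)

  sep : ∀ {a b} → ν (μ a) ≡ ν (μ b) → a ≡ b ⊎ (a ∈ˡ i ∷ j ∷ xs × b ∈ˡ i ∷ j ∷ xs)
  sep eq with proj₂ (proj₂ glue) _ _ eq
  ... | inj₁ μa≡μb    = Sum.map₂ (λ (a∈ , b∈) → weaken a∈ , weaken b∈) (μ-sep μa≡μb)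
  ... | inj₂ (a∼ , b∼) = inj₂ (near a∼ , near b∼)

-- Digraphs and their quotients by vertex labellings.

module _ (G : Digraph) where
  open Digraph G

  Vertex Edge : Set
  Vertex = Fin #V
  Edge   = Fin #E

  Arcs : (Edge → Set) → Rel Vertex 0ℓ
  Arcs P u v = ∃[ e ] (P e × src e ≡ u × tgt e ≡ v)

  arcs-mono : ∀ {P Q : Edge → Set} → (∀ {e} → P e → Q e) → ∀ {u v} → Star (Arcs P) u v → Star (Arcs Q) u v
  arcs-mono P⊆Q = Star.map λ (e , Pe , uv) → e , P⊆Q Pe , uv

  via : ∀ {P : Edge → Set} {e u v} → Star (Arcs P) u (src e) → P e → Star (Arcs P) (tgt e) v →
        Star (Arcs P) u v
  via p Pe q = p ◅◅ (_ , Pe , refl , refl) ◅ q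

  incoming : ∀ {S} → SCSS G S → ∀ {u v} → u ≢ v → ∃[ e ] (e ∈ S × tgt e ≡ v)
  incoming {S} scS {u} {v} u≢v = last (scS u v)
    where
    last : Star (Arc G S) u v → ∃[ e ] (e ∈ S × tgt e ≡ v)
    last p with Star.reverse {U = λ x y → Arc G S y x} id p
    ... | ε                    = contradiction refl u≢v
    ... | (e , e∈S , _ , t≡v) ◅ _ = e , e∈S , t≡v

  -- Every vertex has an edge of `S` entering it, and edges with different targets differ. A lone
  -- vertex would need no edge, hence `u ≢ v`.
  #V≤∣SCSS∣ : ∀ {S} → SCSS G S → ∀ (u v : Vertex) → u ≢ v → #V ≤ ∣ S ∣
  #V≤∣SCSS∣ {S} scS u v u≢v = subst (_≤ ∣ S ∣) (length-tabulate inEdge)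
    (length≤∣p∣ (tabulate⁺ inEdge-injective) (All.tabulate⁺ (λ w → proj₁ (proj₂ (inEdge∈ w)))))
    where
    inEdge∈ : ∀ w → ∃[ e ] (e ∈ S × tgt e ≡ w)
    inEdge∈ w with u Fin.≟ w
    ... | no u≢w   = incoming scS u≢w
    ... | yes refl = incoming scS (u≢v ∘ sym)

    inEdge : Vertex → Edge
    inEdge w = proj₁ (inEdge∈ w)

    inEdge-injective : ∀ {w x} → inEdge w ≡ inEdge x → w ≡ x
    inEdge-injective {w} {x} eq =
      trans (sym (proj₂ (proj₂ (inEdge∈ w)))) (trans (cong tgt eq) (proj₂ (proj₂ (inEdge∈ x))))

  module _ {c : ℕ} (lab : Vertex → Fin c) where

    Internal Crossing : Edge → Set
    Internal e = lab (src e) ≡ lab (tgt e)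
    Crossing e = ¬ Internal e

    -- Arcs of the quotient digraph on the classes of `lab`. The witness keeps the underlying edge,
    -- so that paths of classes can be lifted.
    QArc : (Edge → Set) → Rel (Fin c) 0ℓ
    QArc P i j = ∃[ e ] (P e × lab (src e) ≡ i × lab (tgt e) ≡ j)

    QArc? : ∀ (S : EdgeSet G) i j → Dec (QArc (_∈ S) i j)
    QArc? S i j = Fin.any? λ e → (e ∈? S) ×-dec (lab (src e) Fin.≟ i) ×-dec (lab (tgt e) Fin.≟ j)

    project : ∀ {P u v} → Star (Arcs P) u v → Star (QArc P) (lab u) (lab v)
    project = Star.gmap lab λ (e , Pe , s , t) → e , Pe , cong lab s , cong lab t

    edges : ∀ {P i k xs} → SimplePath (QArc P) i k xs → List Edge
    edges []                  = []
    edges ((e , _) ∷ p by _) = e ∷ edges p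

    length-edges : ∀ {P i k xs} (p : SimplePath (QArc P) i k xs) → length (edges p) ≡ length xs
    length-edges []           = refl
    length-edges (_ ∷ p by _) = cong suc (length-edges p)

    edges⊆ : ∀ {P i k xs} (p : SimplePath (QArc P) i k xs) → All P (edges p)
    edges⊆ []                       = []
    edges⊆ ((_ , Pe , _) ∷ p by _) = Pe ∷ edges⊆ p

    edges-ends : ∀ {P i k xs} (p : SimplePath (QArc P) i k xs) →
                 All (λ e → lab (src e) ∈ˡ i ∷ xs × lab (tgt e) ∈ˡ i ∷ xs) (edges p)
    edges-ends [] = []
    edges-ends ((_ , _ , s , t) ∷ p by _) = (here s , there (here t)) ∷
      All.map (λ (s∈ , t∈) → there s∈ , there t∈) (edges-ends p)

    module _ {Q : Edge → Set} (joined : ∀ u v → lab u ≡ lab v → Star (Arcs Q) u v) where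

      -- A path of classes lifts to a walk of vertices: within each class, `joined` leads from the
      -- head of one edge to the tail of the next.
      toEnd : ∀ {P i k xs} (p : SimplePath (QArc P) i k xs) → (∀ {e} → e ∈ˡ edges p → Q e) →
              ∀ u v → lab u ∈ˡ i ∷ xs → lab v ≡ k → Star (Arcs Q) u v
      toEnd [] _ u v (here u∼) v∼ = joined u v (trans u∼ (sym v∼))
      toEnd ((e , _ , s , t) ∷ p by _) Q⊇ u v (here u∼) v∼ =
        via (joined u (src e) (trans u∼ (sym s))) (Q⊇ (here refl)) (toEnd p (Q⊇ ∘ there) (tgt e) v (here t) v∼)
      toEnd (_ ∷ p by _) Q⊇ u v (there u∈) v∼ = toEnd p (Q⊇ ∘ there) u v u∈ v∼

      fromStart : ∀ {P i k xs} (p : SimplePath (QArc P) i k xs) → (∀ {e} → e ∈ˡ edges p → Q e) →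
                  ∀ u v → lab u ≡ i → lab v ∈ˡ i ∷ xs → Star (Arcs Q) u v
      fromStart _ _ u v u∼ (here v∼) = joined u v (trans u∼ (sym v∼))
      fromStart ((e , _ , s , t) ∷ p by _) Q⊇ u v u∼ (there v∈) =
        via (joined u (src e) (trans u∼ (sym s))) (Q⊇ (here refl)) (fromStart p (Q⊇ ∘ there) (tgt e) v t v∈)

  -- Local optima and the contraction of cycles.

  module LocalOptimum (E′ : EdgeSet G) (scE′ : SCSS G E′) (noStep : ∀ E″ → ¬ Step G E′ E″) where

    noExchange : ∀ {f₁ f₂} → f₁ ∈ E′ → f₂ ∈ E′ → f₁ ≢ f₂ → ∀ e →
                 ¬ SCSS G ((E′ ─ (⁅ f₁ ⁆ ∪ ⁅ f₂ ⁆)) ∪ ⁅ e ⁆)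
    noExchange {f₁} {f₂} f₁∈ f₂∈ f₁≢f₂ e sc =
      noStep _ (_ , _ , E₂⊆E′ , ∣⁅x⁆∪⁅y⁆∣≡2 f₁≢f₂ , ℕ.≤-reflexive (∣⁅x⁆∣≡1 e) , refl , sc)
      where
      E₂⊆E′ : ⁅ f₁ ⁆ ∪ ⁅ f₂ ⁆ ⊆ E′
      E₂⊆E′ x∈ with x∈p∪q⁻ ⁅ f₁ ⁆ ⁅ f₂ ⁆ x∈
      ... | inj₁ x∈₁ = subst (_∈ E′) (sym (x∈⁅y⁆⇒x≡y f₁ x∈₁)) f₁∈
      ... | inj₂ x∈₂ = subst (_∈ E′) (sym (x∈⁅y⁆⇒x≡y f₂ x∈₂)) f₂∈

    kept : ∀ {f₁ f₂ e x} → x ∈ E′ → x ≢ f₁ → x ≢ f₂ → x ∈ (E′ ─ (⁅ f₁ ⁆ ∪ ⁅ f₂ ⁆)) ∪ ⁅ e ⁆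
    kept {f₁} {f₂} x∈ x≢f₁ x≢f₂ = x∈p∪q⁺ (inj₁ (x∈p∧x∉q⇒x∈p─q x∈
      ([ x≢f₁ ∘ x∈⁅y⁆⇒x≡y f₁ , x≢f₂ ∘ x∈⁅y⁆⇒x≡y f₂ ]′ ∘ x∈p∪q⁻ ⁅ f₁ ⁆ ⁅ f₂ ⁆)))

    -- If `f` were missing from `A`, the step that removes `f` and some `g` of `A` and puts `g` back
    -- would delete `f` alone. Such a `g` starts the walk from `tgt f` to `src f`, which is not
    -- empty as `f` is no loop.
    minimal : ∀ {A} → All (_∈ E′) A → (∀ u v → Star (Arcs (_∈ˡ A)) u v) → ∀ {f} → f ∈ E′ → f ∈ˡ A
    minimal {A} A⊆E′ scA {f} f∈ with DecMembership._∈?_ Fin._≟_ f A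
    ... | yes f∈A = f∈A
    ... | no  f∉A = absurd (no-loop f ∘ sym) (scA (tgt f) (src f))
      where
      A⊆E″ : ∀ g {x} → x ∈ˡ A → x ∈ (E′ ─ (⁅ f ⁆ ∪ ⁅ g ⁆)) ∪ ⁅ g ⁆
      A⊆E″ g {x} x∈A with x Fin.≟ g
      ... | yes refl = x∈p∪q⁺ (inj₂ (x∈⁅x⁆ x))
      ... | no x≢g = kept (All.lookup A⊆E′ x∈A) (λ { refl → f∉A x∈A }) x≢g

      absurd : ∀ {u v} → u ≢ v → Star (Arcs (_∈ˡ A)) u v → f ∈ˡ A
      absurd u≢u ε                   = contradiction refl u≢u
      absurd _   ((g , g∈A , _) ◅ _) = contradiction (λ u v → arcs-mono (A⊆E″ g) (scA u v))
        (noExchange f∈ (All.lookup A⊆E′ g∈A) (λ { refl → f∉A g∈A }) g)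

    -- A state of the contraction process: `A` collects the edges of the cycles contracted so far,
    -- and strongly connects each class.
    record Contraction (c : ℕ) : Set where
      field
        label    : Vertex → Fin c
        A        : List Edge
        A⊆E′     : All (_∈ E′) A
        internal : All (Internal label) A
        joined   : ∀ u v → label u ≡ label v → Star (Arcs (_∈ˡ A)) u v

    open Contraction

    -- The effect of contracting a cycle of ℓ + 1 arcs through the classes `xs`.
    record Contracted {c} (C : Contraction c) (xs : List (Fin c)) (ℓ : ℕ) : Set where
      field
        {c′}       : ℕ
        C′         : Contraction c′
        μ          : Fin c → Fin c′
        label≗     : ∀ u → label C′ u ≡ μ (label C u)
        identifies : Identifies μ xs
        length-A   : length (A C′) ≡ suc ℓ ℕ.+ length (A C)
        size       : c ≡ ℓ ℕ.+ c′

    contractCycle : ∀ {c} (C : Contraction c) {f xs} → f ∈ E′ →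
      SimplePath (QArc (label C) (_∈ E′)) (label C (tgt f)) (label C (src f)) xs →
      Contracted C (label C (tgt f) ∷ xs) (length xs)
    contractCycle C {f} {xs} f∈ p with identifyAll (label C (tgt f)) xs (vertices-unique p)
    ... | c′ , μ , c≡ , glue , sep = record
      { C′ = record
        { label    = lab′
        ; A        = A′
        ; A⊆E′     = f∈ ∷ All.++⁺ (edges⊆ lab p) (A⊆E′ C)
        ; internal = glue (end∈ p) (here refl) ∷
                     All.++⁺ (All.map (λ (s∈ , t∈) → glue s∈ t∈) (edges-ends lab p))
                             (All.map (cong μ) (internal C))
        ; joined   = λ u v eq → [ joined-A u v , joined-cycle u v ]′ (sep eq)
        }
      ; μ          = μ
      ; label≗     = λ _ → refl
      ; identifies = glue , sep
      ; length-A   = cong suc (trans (length-++ (edges lab p)) (cong (ℕ._+ length (A C)) (length-edges lab p)))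
      ; size       = c≡
      }
      where
      lab = label C
      lab′ = μ ∘ lab
      A′ = f ∷ edges lab p ++ A C

      end∈ : ∀ {R : Rel _ 0ℓ} {i k ys} → SimplePath R i k ys → k ∈ˡ i ∷ ys
      end∈ []           = here refl
      end∈ (_ ∷ q by _) = there (end∈ q)

      joined-A : ∀ u v → lab u ≡ lab v → Star (Arcs (_∈ˡ A′)) u v
      joined-A u v eq = arcs-mono (there ∘ ∈-++⁺ʳ (edges lab p)) (joined C u v eq)

      joined-cycle : ∀ u v → lab u ∈ˡ lab (tgt f) ∷ xs × lab v ∈ˡ lab (tgt f) ∷ xs → Star (Arcs (_∈ˡ A′)) u v
      -- Follow the path from `u` to its end, close the cycle over `f`, and follow the path again up
      -- to `v`.
      joined-cycle u v (u∈ , v∈) =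
        via (toEnd lab joined-A p (there ∘ ∈-++⁺ˡ) u (src f) u∈ refl) (here refl)
            (fromStart lab joined-A p (there ∘ ∈-++⁺ˡ) (tgt f) v refl v∈)

    -- The tree of 2-cycles.

    module _ {c : ℕ} (lab : Vertex → Fin c) where

      -- A step of a walk in the contracted graph that does not use any
      -- edge antiparallel to f.
      Detour : Edge → Rel Vertex 0ℓ
      Detour f u v = lab u ≡ lab v ⊎
        ∃[ e ] (e ∈ E′ × src e ≡ u × tgt e ≡ v × ¬ (lab (src e) ≡ lab (tgt f) × lab (tgt e) ≡ lab (src f)))

      -- The contracted E′ is a tree of 2-cycles.
      TreeLike : Set
      TreeLike = ∀ {f} → f ∈ E′ → Crossing lab f → ¬ Star (Detour f) (tgt f) (src f)

      Parallel : EdgeSet G → Set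
      Parallel S = ∀ {e} → e ∈ S → Crossing lab e → QArc lab (_∈ E′) (lab (src e)) (lab (tgt e))

      -- Otherwise a walk in `S` from `tgt f` to `src f`, with each crossing edge replaced by the
      -- edge of `E′` parallel to it, is a detour. The case of `E′` itself makes the contracted `E′`
      -- symmetric.
      antiparallel : TreeLike → ∀ {S} → SCSS G S → Parallel S → ∀ {f} → f ∈ E′ → Crossing lab f →
                     QArc lab (_∈ S) (lab (tgt f)) (lab (src f))
      antiparallel tree {S} scS par {f} f∈ cr = decidable-stable (QArc? lab S _ _) λ none →
        let detour : ∀ {u v} → Arc G S u v → Star (Detour f) u v
            detour = λ { (e , e∈ , refl , refl) → detourEdge none e e∈ }
        in tree f∈ cr ((detour ⋆) (scS (tgt f) (src f)))
        where
        detourEdge : ¬ QArc lab (_∈ S) (lab (tgt f)) (lab (src f)) →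
                     ∀ e → e ∈ S → Star (Detour f) (src e) (tgt e)
        detourEdge none e e∈ with lab (src e) Fin.≟ lab (tgt e)
        ... | yes same = inj₁ same ◅ ε
        ... | no  cr-e with par e∈ cr-e
        ...   | g , g∈ , s , t = inj₁ (sym s) ◅
          inj₂ (g , g∈ , refl , refl , λ (s′ , t′) → none (e , e∈ , trans (sym s) s′ , trans (sym t) t′)) ◅
          inj₁ t ◅ ε

    -- Otherwise adding e makes the first two edges redundant on a simple
    -- path that joins the ends of e in the contracted E′: the rest of the
    -- path can be walked backwards.
    parallelTo : ∀ {c} (C : Contraction c) → TreeLike (label C) → Parallel (label C) ⊤
    parallelTo C tree {e} _ cr = decidable-stable (QArc? lab E′ _ _)
      (impossible (simplify (project lab (scE′ (src e) (tgt e)))))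
      where
      lab = label C

      reverseArc : ∀ {i j} → i ≢ j → QArc lab (_∈ E′) i j → QArc lab (_∈ E′) j i
      reverseArc i≢j (f , f∈ , refl , refl) =
        antiparallel lab tree scE′ (λ {g} g∈ _ → g , g∈ , refl , refl) f∈ i≢j

      impossible : ∃[ xs ] SimplePath (QArc lab (_∈ E′)) (lab (src e)) (lab (tgt e)) xs →
                   ¬ ¬ QArc lab (_∈ E′) (lab (src e)) (lab (tgt e))
      impossible (_ , p) none = noShortcut p refl refl
        where
        noShortcut : ∀ {x₀ xₖ xs} → SimplePath (QArc lab (_∈ E′)) x₀ xₖ xs → x₀ ≡ lab (src e) → xₖ ≡ lab (tgt e) → _
        noShortcut [] x₀∼ xₖ∼ = cr (trans (sym x₀∼) xₖ∼)
        noShortcut (a ∷ [] by _) refl refl = none a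
        noShortcut (_∷_by_ {i = x₀} {j = x₁} a₁@(f₁ , f₁∈ , s₁ , t₁)
                 (_∷_by_ {j = x₂} a₂@(f₂ , f₂∈ , s₂ , t₂) p₂ (x₁≢x₂ ∷ x₁∉))
                 (x₀≢x₁ ∷ x₀≢x₂ ∷ x₀∉)) refl refl =
          noExchange f₁∈ f₂∈ f₁≢f₂ e λ u v → (replace ⋆) (scE′ u v)
          where
          E″ = (E′ ─ (⁅ f₁ ⁆ ∪ ⁅ f₂ ⁆)) ∪ ⁅ e ⁆
          W = Star (Arc G E″)

          f₁≢f₂ : f₁ ≢ f₂
          f₁≢f₂ refl = x₀≢x₁ (trans (sym s₁) s₂)

          f₁-crossing : Crossing lab f₁
          f₁-crossing eq = x₀≢x₁ (trans (sym s₁) (trans eq t₁))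

          f₂-crossing : Crossing lab f₂
          f₂-crossing eq = x₁≢x₂ (trans (sym s₂) (trans eq t₂))

          stay : ∀ u v → lab u ≡ lab v → W u v
          stay u v eq = arcs-mono (λ g∈A → kept (All.lookup (A⊆E′ C) g∈A)
            (λ { refl → f₁-crossing (All.lookup (internal C) g∈A) })
            (λ { refl → f₂-crossing (All.lookup (internal C) g∈A) })) (joined C u v eq)

          across : ∀ {i j} → (a : QArc lab (_∈ E′) i j) → proj₁ a ≢ f₁ → proj₁ a ≢ f₂ →
                   ∀ u v → lab u ≡ i → lab v ≡ j → W u v
          across (g , g∈ , s , t) ≢₁ ≢₂ u v u∼ v∼ =
            via (stay u (src g) (trans u∼ (sym s))) (kept g∈ ≢₁ ≢₂) (stay (tgt g) v (trans t (sym v∼)))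

          -- The reversed arcs start in classes other than `x₀` and `x₁`, so they are neither `f₁`
          -- nor `f₂`.
          back : ∀ {i k xs} → SimplePath (QArc lab (_∈ E′)) i k xs → All (x₀ ≢_) xs → All (x₁ ≢_) xs →
                 ∀ u v → lab u ≡ k → lab v ≡ i → W u v
          back [] _ _ u v u∼ v∼ = stay u v (trans u∼ (sym v∼))
          back (a ∷ q by (i≢j ∷ _)) (x₀≢j ∷ x₀∉) (x₁≢j ∷ x₁∉) u v u∼ v∼ with reverseArc i≢j a
          ... | r@(h , _ , s , t) = back q x₀∉ x₁∉ u (src h) u∼ s ◅◅
            across r (λ { refl → x₀≢j (trans (sym s₁) s) }) (λ { refl → x₁≢j (trans (sym s₂) s) }) (src h) v s v∼

          2⇒1 : ∀ u v → lab u ≡ x₂ → lab v ≡ x₁ → W u v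
          2⇒1 with reverseArc x₁≢x₂ a₂
          ... | r@(h , _ , s , t) = across r (λ { refl → x₀≢x₂ (trans (sym s₁) s) })
                                           (λ { refl → x₁≢x₂ (trans (sym s₂) s) })

          1⇒0 : ∀ u v → lab u ≡ x₁ → lab v ≡ x₀ → W u v
          1⇒0 with reverseArc x₀≢x₁ a₁
          ... | r@(h , _ , s , t) = across r (λ { refl → x₀≢x₁ (trans (sym s₁) s) })
                                           (λ { refl → x₀≢x₂ (trans (sym t) t₂) })

          0⇒2 : ∀ u v → lab u ≡ x₀ → lab v ≡ x₂ → W u v
          0⇒2 u v u∼ v∼ = via (stay u (src e) u∼) (x∈p∪q⁺ (inj₂ (x∈⁅x⁆ e))) (back p₂ x₀∉ x₁∉ (tgt e) v refl v∼)

          -- `f₁` is replaced by a walk through the classes x₀, x₂, x₁ and `f₂` by one through x₁,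
          -- x₀, x₂; the part from x₀ to x₂ crosses `e` and comes back along the path.
          replace : ∀ {u v} → Arc G E′ u v → W u v
          replace (g , g∈ , refl , refl) with g Fin.≟ f₁ | g Fin.≟ f₂
          ... | yes refl | _        = 0⇒2 (src f₁) (tgt f₂) s₁ t₂ ◅◅ 2⇒1 (tgt f₂) (tgt f₁) t₂ t₁
          ... | no _     | yes refl = 1⇒0 (src f₂) (src f₁) s₂ s₁ ◅◅ 0⇒2 (src f₁) (tgt f₂) s₁ t₂
          ... | no g≢f₁  | no g≢f₂  = (g , kept g∈ g≢f₁ g≢f₂ , refl , refl) ◅ ε

    -- Charging the contracted edges to an arbitrary SCSS.

    module _ {S : EdgeSet G} (scS : SCSS G S) where

      -- B holds edges of S inside the classes.  Contracting a cycle of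
      -- ℓ + 1 arcs lowers c by ℓ, which keeps the inequality when ℓ ≥ 2
      -- since then 4(ℓ + 1) ≤ 6ℓ; for ℓ = 1 two more edges in B pay for it.
      Charged : ∀ {c} → Contraction c → List Edge → Set
      Charged {c} C B = 4 ℕ.* length (A C) ℕ.+ 6 ℕ.* c ≤ 6 ℕ.* #V ℕ.+ length B

      -- The summand `c` covers the one-vertex digraph, where `S` can be empty but there is at least
      -- one class.
      #V≤∣S∣+ : ∀ {c} → (Vertex → Fin c) → #V ≤ ∣ S ∣ ℕ.+ c
      #V≤∣S∣+ lab with #V | #V≤∣SCSS∣ scS
      ... | zero        | _ = z≤n
      ... | suc (suc _) | bound = ℕ.≤-trans (bound zero (suc zero) λ ()) (ℕ.m≤m+n _ _)
      #V≤∣S∣+ {zero}  lab | suc zero | _ with () ← lab zero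
      #V≤∣S∣+ {suc c} lab | suc zero | _ = ℕ.≤-trans (s≤s z≤n) (ℕ.m≤n+m (suc c) ∣ S ∣)

      -- By minimality `E′` lies in `A`. Of the factor 7, six come from the vertices and one from
      -- `B`; the terms `6 * c` cancel.
      contracted⇒bound : ∀ {c} (C : Contraction c) {B} → Unique B → All (_∈ S) B → Charged C B →
                         (∀ u v → label C u ≡ label C v) → 4 ℕ.* ∣ E′ ∣ ≤ 7 ℕ.* ∣ S ∣
      contracted⇒bound {c} C {B} B! B⊆S charged connected =
        ℕ.+-cancelʳ-≤ (6 ℕ.* c) _ _ (begin
          4 ℕ.* ∣ E′ ∣ ℕ.+ 6 ℕ.* c           ≤⟨ ℕ.+-monoˡ-≤ _ (ℕ.*-monoʳ-≤ 4 (∣p∣≤length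
                                                (minimal (A⊆E′ C) λ u v → joined C u v (connected u v)))) ⟩
          4 ℕ.* length (A C) ℕ.+ 6 ℕ.* c     ≤⟨ charged ⟩
          6 ℕ.* #V ℕ.+ length B              ≤⟨ ℕ.+-mono-≤ (ℕ.*-monoʳ-≤ 6 (#V≤∣S∣+ (label C))) (length≤∣p∣ B! B⊆S) ⟩
          6 ℕ.* (∣ S ∣ ℕ.+ c) ℕ.+ ∣ S ∣      ≡⟨ rearrange ∣ S ∣ c ⟩
          7 ℕ.* ∣ S ∣ ℕ.+ 6 ℕ.* c            ∎)
        where
        open ℕ.≤-Reasoning
        rearrange : ∀ s c → 6 ℕ.* (s ℕ.+ c) ℕ.+ s ≡ 7 ℕ.* s ℕ.+ 6 ℕ.* c
        rearrange = solve-∀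

      -- Each round contracts a 2-cycle of `f` and `g` and adds to `B` the edges of `S` antiparallel
      -- to them. These are new, because they cross between classes while all of `B` is internal.
      contractTree : ∀ {c} → Acc ℕ._<_ c → (C : Contraction c) → TreeLike (label C) → Parallel (label C) S →
                     ∀ {B} → Unique B → All (_∈ S) B → All (Internal (label C)) B → Charged C B →
                     4 ℕ.* ∣ E′ ∣ ≤ 7 ℕ.* ∣ S ∣
      contractTree {c} (acc rec) C tree par {B} B! B⊆S B-internal charged
        with Fin.any? (λ f → (f ∈? E′) ×-dec ¬? (label C (src f) Fin.≟ label C (tgt f)))
      ... | no none = contracted⇒bound C B! B⊆S charged λ u v →
        Star.fold (λ x y → label C x ≡ label C y)
          (λ { (f , f∈ , refl , refl) eq →
               trans (decidable-stable (label C (src f) Fin.≟ label C (tgt f)) (λ cr → none (f , f∈ , cr))) eq })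
          refl (scE′ u v)
      ... | yes (f , f∈ , cr)
        with antiparallel (label C) tree scE′ (λ {g} g∈ _ → g , g∈ , refl , refl) f∈ cr
      ... | a@(g , g∈ , s , t)
        with antiparallel (label C) tree scS par f∈ cr
           | antiparallel (label C) tree scS par g∈ (λ eq → cr (sym (trans (sym s) (trans eq t))))
      ... | b₁ , b₁∈ , s₁ , t₁ | b₂ , b₂∈ , s₂ , t₂ =
        contractTree (rec smaller) C′ tree′ par′
          ((b₁≢b₂ ∷ fresh b₁ b₁-crossing) ∷ fresh b₂ b₂-crossing ∷ B!) (b₁∈ ∷ b₂∈ ∷ B⊆S)
          (intern (glue (∈ends s₁) (∈ends′ t₁)) ∷
           intern (glue (∈ends′ (trans s₂ t)) (∈ends (trans t₂ s))) ∷
           All.map (λ eq → intern (cong μ eq)) B-internal)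
          charged′
        where
        lab = label C
        Y≢X : lab (tgt f) ≢ lab (src f)
        Y≢X = cr ∘ sym

        open Contracted (contractCycle C f∈ (a ∷ [] by (Y≢X ∷ [])))

        glue = proj₁ identifies
        sep  = proj₂ identifies

        ends : List (Fin c)
        ends = lab (tgt f) ∷ lab (src f) ∷ []

        ∈ends : ∀ {i} → i ≡ lab (tgt f) → i ∈ˡ ends
        ∈ends = here
        ∈ends′ : ∀ {i} → i ≡ lab (src f) → i ∈ˡ ends
        ∈ends′ = there ∘ here

        intern : ∀ {u v} → μ (lab u) ≡ μ (lab v) → label C′ u ≡ label C′ v
        intern {u} {v} eq = trans (label≗ u) (trans eq (sym (label≗ v)))

        extern : ∀ {u v} → label C′ u ≡ label C′ v → μ (lab u) ≡ μ (lab v)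
        extern {u} {v} eq = trans (sym (label≗ u)) (trans eq (label≗ v))

        coarser : ∀ {u v} → lab u ≡ lab v → label C′ u ≡ label C′ v
        coarser = intern ∘ cong μ

        smaller : c′ ℕ.< c
        smaller = ℕ.≤-reflexive (sym size)

        -- A detour in the coarser quotient refines to one in the finer by passing over `f` or `g`
        -- inside the merged class; neither is antiparallel to `h`, which still crosses after the
        -- merge.
        tree′ : TreeLike (label C′)
        tree′ {h} h∈ crₕ walk = tree h∈ (crₕ ∘ coarser) ((refine ⋆) walk)
          where
          reroute : ∀ {e} → e ∈ E′ → lab (src e) ∈ˡ ends × lab (tgt e) ∈ˡ ends →
                    ∀ {u v} → lab u ≡ lab (src e) → lab v ≡ lab (tgt e) → Star (Detour lab h) u v
          reroute {e} e∈ (s∈ , t∈) u∼ v∼ = inj₁ u∼ ◅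
            inj₂ (e , e∈ , refl , refl , λ (s≡ , t≡) →
              crₕ (intern (sym (trans (cong μ (sym s≡)) (trans (glue s∈ t∈) (cong μ t≡)))))) ◅
            inj₁ (sym v∼) ◅ ε

          refine : ∀ {u v} → Detour (label C′) h u v → Star (Detour lab h) u v
          refine (inj₂ (e , e∈ , s≡ , t≡ , not)) =
            inj₂ (e , e∈ , s≡ , t≡ , λ (s∼ , t∼) → not (coarser s∼ , coarser t∼)) ◅ ε
          refine (inj₁ eq) with sep (extern eq)
          ... | inj₁ same = inj₁ same ◅ ε
          ... | inj₂ (here u∼ , here v∼) = inj₁ (trans u∼ (sym v∼)) ◅ ε
          ... | inj₂ (there (here u∼) , there (here v∼)) = inj₁ (trans u∼ (sym v∼)) ◅ ε
          ... | inj₂ (here u∼ , there (here v∼)) =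
            reroute g∈ (∈ends s , ∈ends′ t) (trans u∼ (sym s)) (trans v∼ (sym t))
          ... | inj₂ (there (here u∼) , here v∼) =
            reroute f∈ (∈ends′ refl , ∈ends refl) u∼ v∼

        par′ : Parallel (label C′) S
        par′ e∈ crₑ with par e∈ (crₑ ∘ coarser)
        ... | h , h∈ , s≡ , t≡ = h , h∈ , coarser s≡ , coarser t≡

        b₁≢b₂ : b₁ ≢ b₂
        b₁≢b₂ refl = Y≢X (trans (sym s₁) (trans s₂ t))

        b₁-crossing : Crossing lab b₁
        b₁-crossing eq = Y≢X (trans (sym s₁) (trans eq t₁))

        b₂-crossing : Crossing lab b₂
        b₂-crossing eq = Y≢X (sym (trans (sym (trans s₂ t)) (trans eq (trans t₂ s))))

        fresh : ∀ b → Crossing lab b → All (b ≢_) B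
        fresh b cr-b = All.map (λ { internal refl → cr-b internal }) B-internal

        charged′ : Charged C′ (b₁ ∷ b₂ ∷ B)
        charged′ = begin
          4 ℕ.* length (A C′) ℕ.+ 6 ℕ.* c′               ≡⟨ cong (λ ℓ → 4 ℕ.* ℓ ℕ.+ 6 ℕ.* c′) length-A ⟩
          4 ℕ.* (2 ℕ.+ length (A C)) ℕ.+ 6 ℕ.* c′        ≡⟨ lhs (length (A C)) c′ ⟩
          2 ℕ.+ (4 ℕ.* length (A C) ℕ.+ 6 ℕ.* suc c′)    ≡⟨ cong (λ m → 2 ℕ.+ (4 ℕ.* length (A C) ℕ.+ 6 ℕ.* m)) size ⟨
          2 ℕ.+ (4 ℕ.* length (A C) ℕ.+ 6 ℕ.* c)         ≤⟨ ℕ.+-monoʳ-≤ 2 charged ⟩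
          2 ℕ.+ (6 ℕ.* #V ℕ.+ length B)                  ≡⟨ rhs (6 ℕ.* #V) (length B) ⟩
          6 ℕ.* #V ℕ.+ (2 ℕ.+ length B)                  ∎
          where
          open ℕ.≤-Reasoning
          lhs : ∀ a c → 4 ℕ.* (2 ℕ.+ a) ℕ.+ 6 ℕ.* c ≡ 2 ℕ.+ (4 ℕ.* a ℕ.+ 6 ℕ.* suc c)
          lhs = solve-∀
          rhs : ∀ n b → 2 ℕ.+ (n ℕ.+ b) ≡ n ℕ.+ (2 ℕ.+ b)
          rhs = solve-∀

      -- Doubly negated, because the existence of a long cycle is not decided.
      contractCycles : ∀ {c} → Acc ℕ._<_ c → (C : Contraction c) → Charged C [] →
                       ¬ ¬ 4 ℕ.* ∣ E′ ∣ ≤ 7 ℕ.* ∣ S ∣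
      contractCycles {c} (acc rec) C charged exceeds =
        exceeds (contractTree (acc rec) C tree (λ _ → parallelTo C tree ∈⊤) [] [] [] charged)
        where
        lab = label C

        -- Contracting such a cycle leaves fewer classes, and the recursive call then refutes
        -- `exceeds`.
        noLongCycle : ∀ {f} → f ∈ E′ → ∀ {xs} →
          SimplePath (QArc lab (_∈ E′)) (lab (tgt f)) (lab (src f)) xs → ¬ 2 ≤ length xs
        noLongCycle f∈ {xs} p 2≤ℓ = contractCycles (rec smaller) C′ charged′ exceeds
          where
          open Contracted (contractCycle C f∈ p)

          smaller : c′ ℕ.< c
          smaller = subst (c′ ℕ.<_) (sym size) (ℕ.+-monoˡ-≤ c′ (ℕ.≤-trans (s≤s z≤n) 2≤ℓ))

          charged′ : Charged C′ []
          charged′ = begin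
            4 ℕ.* length (A C′) ℕ.+ 6 ℕ.* c′                          ≡⟨ cong (λ ℓ → 4 ℕ.* ℓ ℕ.+ 6 ℕ.* c′) length-A ⟩
            4 ℕ.* suc (length xs ℕ.+ length (A C)) ℕ.+ 6 ℕ.* c′       ≡⟨ lhs (length xs) (length (A C)) c′ ⟩
            (2 ℕ.* 2 ℕ.+ 4 ℕ.* length xs) ℕ.+ (4 ℕ.* length (A C) ℕ.+ 6 ℕ.* c′)
              ≤⟨ ℕ.+-monoˡ-≤ _ (ℕ.+-monoˡ-≤ (4 ℕ.* length xs) (ℕ.*-monoʳ-≤ 2 2≤ℓ)) ⟩
            (2 ℕ.* length xs ℕ.+ 4 ℕ.* length xs) ℕ.+ (4 ℕ.* length (A C) ℕ.+ 6 ℕ.* c′) ≡⟨ rhs (length xs) (length (A C)) c′ ⟩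
            4 ℕ.* length (A C) ℕ.+ 6 ℕ.* (length xs ℕ.+ c′)           ≡⟨ cong (λ m → 4 ℕ.* length (A C) ℕ.+ 6 ℕ.* m) size ⟨
            4 ℕ.* length (A C) ℕ.+ 6 ℕ.* c                            ≤⟨ charged ⟩
            6 ℕ.* #V ℕ.+ 0                                            ∎
            where
            open ℕ.≤-Reasoning
            lhs : ∀ ℓ a c → 4 ℕ.* suc (ℓ ℕ.+ a) ℕ.+ 6 ℕ.* c ≡ (2 ℕ.* 2 ℕ.+ 4 ℕ.* ℓ) ℕ.+ (4 ℕ.* a ℕ.+ 6 ℕ.* c)
            lhs = solve-∀
            rhs : ∀ ℓ a c → (2 ℕ.* ℓ ℕ.+ 4 ℕ.* ℓ) ℕ.+ (4 ℕ.* a ℕ.+ 6 ℕ.* c) ≡ 4 ℕ.* a ℕ.+ 6 ℕ.* (ℓ ℕ.+ c)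
            rhs = solve-∀

        tree : TreeLike lab
        -- A simplified detour of one arc would be antiparallel to `f`; a longer one closes with `f`
        -- to a cycle of at least three arcs.
        tree {f} f∈ cr walk = short (proj₂ (simplify (labels walk))) refl refl
          where
          NotReverse : Edge → Set
          NotReverse e = e ∈ E′ × ¬ (lab (src e) ≡ lab (tgt f) × lab (tgt e) ≡ lab (src f))

          labels : ∀ {u v} → Star (Detour lab f) u v → Star (QArc lab NotReverse) (lab u) (lab v)
          labels ε = ε
          labels {v = v} (inj₁ eq ◅ w) = subst (λ i → Star (QArc lab NotReverse) i (lab v)) (sym eq) (labels w)
          labels (inj₂ (e , e∈ , refl , refl , not) ◅ w) = (e , (e∈ , not) , refl , refl) ◅ labels w

          short : ∀ {i k xs} → SimplePath (QArc lab NotReverse) i k xs → i ≡ lab (tgt f) → ¬ k ≡ lab (src f)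
          short [] i∼ k∼ = cr (trans (sym k∼) i∼)
          short ((e , (_ , not) , s , t) ∷ [] by _) i∼ k∼ = not (trans s i∼ , trans t k∼)
          short p@(_ ∷ (_ ∷ _ by _) by _) refl refl =
            noLongCycle f∈ (mapPath (λ (e , (e∈ , _) , st) → e , e∈ , st) p) (s≤s (s≤s z≤n))

      -- The process starts from singleton classes, where the charge holds with equality. The bound
      -- is decidable, so its double negation suffices.
      2-exchange-bound : 4 ℕ.* ∣ E′ ∣ ≤ 7 ℕ.* ∣ S ∣
      2-exchange-bound = decidable-stable (_ ℕ.≤? _) (contractCycles (<-wellFounded #V) discrete
        (ℕ.≤-reflexive (sym (ℕ.+-identityʳ _))))
        where
        discrete : Contraction #V
        discrete = record
          { label = id ; A = [] ; A⊆E′ = [] ; internal = [] ; joined = λ { _ _ refl → ε } }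

-- Subsets of disjoint sums, cuts, and single deletions.

module _ {m n : ℕ} where

  ∈-++ˡ : ∀ {p : Subset m} {q : Subset n} {i} → i ∈ p → i ↑ˡ n ∈ p ++ᵛ q
  ∈-++ˡ {p} {q} {i} i∈p = Vec.lookup⇒[]= _ (p ++ᵛ q) (trans (Vec.lookup-++ˡ p q i) (Vec.[]=⇒lookup i∈p))

  ∈-++ʳ : ∀ {p : Subset m} {q : Subset n} {i} → i ∈ q → m ↑ʳ i ∈ p ++ᵛ q
  ∈-++ʳ {p} {q} {i} i∈q = Vec.lookup⇒[]= _ (p ++ᵛ q) (trans (Vec.lookup-++ʳ p q i) (Vec.[]=⇒lookup i∈q))

  ∈-++ʳ⁻ : ∀ {p : Subset m} {q : Subset n} {i} → m ↑ʳ i ∈ p ++ᵛ q → i ∈ q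
  ∈-++ʳ⁻ {p} {q} {i} i∈ = Vec.lookup⇒[]= _ q (trans (sym (Vec.lookup-++ʳ p q i)) (Vec.[]=⇒lookup i∈))

∣p++q∣≡∣p∣+∣q∣ : ∀ {m n} (p : Subset m) (q : Subset n) → ∣ p ++ᵛ q ∣ ≡ ∣ p ∣ ℕ.+ ∣ q ∣
∣p++q∣≡∣p∣+∣q∣ []          q = refl
∣p++q∣≡∣p∣+∣q∣ (true  ∷ p) q = cong suc (∣p++q∣≡∣p∣+∣q∣ p q)
∣p++q∣≡∣p∣+∣q∣ (false ∷ p) q = ∣p++q∣≡∣p∣+∣q∣ p q

crossingStep : ∀ {I : Set} {R : Rel I 0ℓ} {X : I → Set} → Decidable X → ∀ {u v} → Star R u v → X u → ¬ X v →
               ∃[ x ] ∃[ y ] (R x y × X x × ¬ X y)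
crossingStep X? ε Xu ¬Xv = contradiction Xu ¬Xv
crossingStep X? (_◅_ {j = w} r p) Xu ¬Xv with X? w
... | yes Xw = crossingStep X? p Xw ¬Xv
... | no ¬Xw = _ , _ , r , Xu , ¬Xw

-- With E₁ = ⁅ f ⁆ for an edge f of S, edges outside S are deleted one by one.
reachable : ∀ (G : Digraph) {S} → SCSS G S → Nonempty S → ∀ {T} → S ⊆ T → Star (Step G) T S
reachable G {S} scS (f , f∈S) S⊆T = go (<-wellFounded _) S⊆T
  where
  go : ∀ {T} → Acc ℕ._<_ ∣ T ∣ → S ⊆ T → Star (Step G) T S
  go {T} (acc rec) S⊆T with Fin.any? (λ e → (e ∈? T) ×-dec ¬? (e ∈? S))
  ... | no  none = subst (λ T → Star (Step G) T S) (⊆-antisym S⊆T λ {e} e∈T →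
                     decidable-stable (e ∈? S) λ e∉S → none (e , e∈T , e∉S)) ε
  ... | yes (e , e∈T , e∉S) =
    (⁅ e ⁆ ∪ ⁅ f ⁆ , ⁅ f ⁆ , E₂⊆T , ∣⁅x⁆∪⁅y⁆∣≡2 e≢f , ℕ.≤-reflexive (∣⁅x⁆∣≡1 f) , refl ,
      λ u v → Star.map (λ (x , x∈ , uv) → x , S⊆T′ x∈ , uv) (scS u v)) ◅
    go (rec (p⊂q⇒∣p∣<∣q∣ (T′⊆T , e , e∈T , e∉T′))) S⊆T′
    where
    E₂ = ⁅ e ⁆ ∪ ⁅ f ⁆
    T′ = (T ─ E₂) ∪ ⁅ f ⁆
    e≢f : e ≢ f
    e≢f refl = e∉S f∈S
    E₂⊆T : E₂ ⊆ T
    E₂⊆T x∈ with x∈p∪q⁻ ⁅ e ⁆ ⁅ f ⁆ x∈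
    ... | inj₁ x∈e = subst (_∈ T) (sym (x∈⁅y⁆⇒x≡y e x∈e)) e∈T
    ... | inj₂ x∈f = subst (_∈ T) (sym (x∈⁅y⁆⇒x≡y f x∈f)) (S⊆T f∈S)
    T′⊆T : T′ ⊆ T
    T′⊆T x∈ with x∈p∪q⁻ (T ─ E₂) ⁅ f ⁆ x∈
    ... | inj₁ x∈T─ = p─q⊆p T E₂ x∈T─
    ... | inj₂ x∈f  = subst (_∈ T) (sym (x∈⁅y⁆⇒x≡y f x∈f)) (S⊆T f∈S)
    e∉T′ : e ∉ T′
    e∉T′ e∈ with x∈p∪q⁻ (T ─ E₂) ⁅ f ⁆ e∈
    ... | inj₁ e∈T─ = x∈p─q⇒x∉q T E₂ e∈T─ (x∈p∪q⁺ (inj₁ (x∈⁅x⁆ e)))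
    ... | inj₂ e∈f  = e≢f (x∈⁅y⁆⇒x≡y f e∈f)
    S⊆T′ : S ⊆ T′
    S⊆T′ {x} x∈S with x Fin.≟ f
    ... | yes refl = x∈p∪q⁺ (inj₂ (x∈⁅x⁆ x))
    ... | no  x≢f  = x∈p∪q⁺ (inj₁ (x∈p∧x∉q⇒x∈p─q (S⊆T x∈S)
      ([ (λ x∈e → e∉S (subst (_∈ S) (x∈⁅y⁆⇒x≡y e x∈e) x∈S)) , x≢f ∘ x∈⁅y⁆⇒x≡y f ]′ ∘ x∈p∪q⁻ ⁅ e ⁆ ⁅ f ⁆)))

-- The tight instance.

module Tight (s : ℕ) where

  -- At least one triangle, so that there is a last index from which the Hamiltonian cycle returns
  -- to `r`.
  t : ℕ
  t = suc s

  -- A bush is a hub with its leaf: `r` sits at the common vertex, `a i` and `b i` at the other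
  -- corners of triangle `i`.
  Bush : Set
  Bush = Unit ⊎ (Fin t ⊎ Fin t)

  pattern r   = inj₁ tt
  pattern a i = inj₂ (inj₁ i)
  pattern b i = inj₂ (inj₂ i)

  -- (x , true) is a hub and (x , false) the leaf hanging from it.
  Node : Set
  Node = Bush × Bool

  -- The `Local` links form `E′`. `bush x` and `tri k j` are indexed by their tails, `ham x` by its
  -- head.
  Local Link : Set
  Local = Node ⊎ (Fin 3 × Fin t)
  Link  = Local ⊎ Node

  pattern bush x = inj₁ (inj₁ x)
  pattern tri k j = inj₁ (inj₂ (k , j))
  pattern ham x = inj₂ x

  -- The Hamiltonian cycle runs twice through the bushes in the order
  -- r, b₀, a₀, b₁, a₁, …, as their number is odd and every edge switches
  -- between hub and leaf; θ is the predecessor in that order.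
  θ : Bush → Bush
  θ r           = a (Fin.fromℕ s)
  θ (a i)       = b i
  θ (b zero)    = r
  θ (b (suc i)) = a (inject₁ i)

  corner : Fin 3 → Fin t → Bush
  corner zero             _ = r
  corner (suc zero)       j = a j
  corner (suc (suc zero)) j = b j

  next : Fin 3 → Fin 3
  next zero             = suc zero
  next (suc zero)       = suc (suc zero)
  next (suc (suc zero)) = zero

  source target : Link → Node
  source (bush x)      = x
  source (tri k j)     = corner k j , true
  source (ham (x , h)) = θ x , not h
  target (bush (x , h)) = x , not h
  target (tri k j)      = corner (next k) j , true
  target (ham x)        = x

  _≟ᵇ_ : DecidableEquality Bush
  _≟ᵇ_ = Sum.≡-dec (λ _ _ → yes refl) (Sum.≡-dec Fin._≟_ Fin._≟_)

  _≟ⁿ_ : DecidableEquality Node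
  _≟ⁿ_ = ≡-dec _≟ᵇ_ Bool._≟_

  θ≢ : ∀ x → θ x ≢ x
  θ≢ (b zero) ()
  θ≢ (b (suc i)) ()

  -- A left inverse to taking ends, which excludes parallel edges. Only triangle edges join two
  -- hubs; between a hub and a leaf, `bush` keeps the bush and `ham` changes it.
  decode : Node → Node → Link
  decode (x , true) (y , true) = chord x y
    where
    chord : Bush → Bush → Link
    chord r     (a j) = tri zero j
    chord (a j) _     = tri (suc zero) j
    chord (b j) _     = tri (suc (suc zero)) j
    -- An arbitrary value: no link joins these hubs.
    chord _     _     = bush (r , true)
  decode (x , h) (y , h′) with x ≟ᵇ y
  ... | yes _ = bush (x , h)
  ... | no  _ = ham (y , h′)

  decode-ends : ∀ e → decode (source e) (target e) ≡ e
  decode-ends (tri zero j)             = refl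
  decode-ends (tri (suc zero) j)       = refl
  decode-ends (tri (suc (suc zero)) j) = refl
  decode-ends (bush (x , false)) with x ≟ᵇ x
  ... | yes _  = refl
  ... | no x≢x = contradiction refl x≢x
  decode-ends (bush (x , true)) with x ≟ᵇ x
  ... | yes _  = refl
  ... | no x≢x = contradiction refl x≢x
  decode-ends (ham (x , false)) with θ x ≟ᵇ x
  ... | yes eq = contradiction eq (θ≢ x)
  ... | no  _  = refl
  decode-ends (ham (x , true)) with θ x ≟ᵇ x
  ... | yes eq = contradiction eq (θ≢ x)
  ... | no  _  = refl

  ends-injective : ∀ e f → source e ≡ source f → target e ≡ target f → e ≡ f
  ends-injective e f s≡ t≡ = trans (sym (decode-ends e)) (trans (cong₂ decode s≡ t≡) (decode-ends f))

  source≢target : ∀ e → source e ≢ target e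
  source≢target (tri zero j) ()
  source≢target (tri (suc zero) j) ()
  source≢target (tri (suc (suc zero)) j) ()
  source≢target (bush (x , false)) ()
  source≢target (bush (x , true)) ()
  source≢target (ham (x , h)) eq = θ≢ x (cong proj₁ eq)

  #nodes #local : ℕ
  #nodes = (1 ℕ.+ (t ℕ.+ t)) ℕ.* 2
  #local = #nodes ℕ.+ 3 ℕ.* t

  nodes : Fin #nodes ↔ Node
  nodes = ((Fin.1↔⊤ ⊎-↔ Fin.+↔⊎) ↔-∘ Fin.+↔⊎ ×-↔ Fin.2↔Bool) ↔-∘ Fin.*↔×

  locals : Fin #local ↔ Local
  locals = (nodes ⊎-↔ Fin.*↔×) ↔-∘ Fin.+↔⊎

  links : Fin (#local ℕ.+ #nodes) ↔ Link
  links = (locals ⊎-↔ nodes) ↔-∘ Fin.+↔⊎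

  module Nodes = Inverse nodes
  module Links = Inverse links

  G : Digraph
  G = record
    { #V          = #nodes
    ; #E          = #local ℕ.+ #nodes
    ; src         = Nodes.from ∘ source ∘ Links.to
    ; tgt         = Nodes.from ∘ target ∘ Links.to
    ; no-loop     = λ e eq → source≢target (Links.to e) (node-injective eq)
    ; no-parallel = λ e f s≡ t≡ → Injection.injective (↔⇒↣ links)
                      (ends-injective (Links.to e) (Links.to f) (node-injective s≡) (node-injective t≡))
    }
    where
    node-injective : ∀ {x y} → Nodes.from x ≡ Nodes.from y → x ≡ y
    node-injective = Injection.injective (↔⇒↣ (↔-sym nodes))

  E′ H : EdgeSet G
  E′ = ⊤ {#local} ++ᵛ ⊥ {#nodes}
  H  = ⊥ {#local} ++ᵛ ⊤ {#nodes}

  ∣E′∣ : ∣ E′ ∣ ≡ #local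
  ∣E′∣ = trans (∣p++q∣≡∣p∣+∣q∣ (⊤ {#local}) (⊥ {#nodes}))
    (trans (cong₂ ℕ._+_ (∣⊤∣≡n #local) (∣⊥∣≡0 #nodes)) (ℕ.+-identityʳ #local))

  ∣H∣ : ∣ H ∣ ≡ #nodes
  ∣H∣ = trans (∣p++q∣≡∣p∣+∣q∣ (⊥ {#local}) (⊤ {#nodes})) (cong₂ ℕ._+_ (∣⊥∣≡0 #local) (∣⊤∣≡n #nodes))

  local∈E′ : ∀ l → Links.from (inj₁ l) ∈ E′
  local∈E′ l = ∈-++ˡ {p = ⊤ {#local}} ∈⊤

  ham∈H : ∀ x → Links.from (ham x) ∈ H
  ham∈H x = ∈-++ʳ {p = ⊥ {#local}} {q = ⊤ {#nodes}} ∈⊤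

  ∈E′⇒local : ∀ {i} → i ∈ E′ → ∃[ l ] i ≡ Links.from (inj₁ l)
  ∈E′⇒local {i} i∈ = go (Links.to i) (sym (Links.strictlyInverseʳ i))
    where
    go : ∀ e → i ≡ Links.from e → ∃[ l ] i ≡ Links.from (inj₁ l)
    go (inj₁ l) eq = l , eq
    go (ham x)  eq = contradiction (∈-++ʳ⁻ {p = ⊤ {#local}} {q = ⊥ {#nodes}} (subst (_∈ E′) eq i∈)) ∉⊥

  Walk : (Link → Set) → Rel Node 0ℓ
  Walk P = Star (λ x y → ∃[ e ] (P e × source e ≡ x × target e ≡ y))

  walks⇒SCSS : ∀ {P : Link → Set} {S} → (∀ {e} → P e → Links.from e ∈ S) → ∀ x₀ →
               (∀ x → Walk P x x₀) → (∀ x → Walk P x₀ x) → SCSS G S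
  walks⇒SCSS {P} {S} P⊆S x₀ to from u v = subst₂ (Star (Arc G S)) (Nodes.strictlyInverseʳ u) (Nodes.strictlyInverseʳ v)
    (Star.gmap Nodes.from arc (to (Nodes.to u) ◅◅ from (Nodes.to v)))
    where
    arc : ∀ {x y} → ∃[ e ] (P e × source e ≡ x × target e ≡ y) → Arc G S (Nodes.from x) (Nodes.from y)
    arc (e , Pe , refl , refl) = Links.from e , P⊆S Pe ,
      cong (Nodes.from ∘ source) (Links.strictlyInverseˡ e) , cong (Nodes.from ∘ target) (Links.strictlyInverseˡ e)

  cut : ∀ {S} → SCSS G S → ∀ {X : Node → Set} → Decidable X → ∀ {x y} → X x → ¬ X y →
        ∃[ e ] (Links.from e ∈ S × X (source e) × ¬ X (target e))
  cut {S} scS {X} X? {x} {y} Xx ¬Xy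
    with crossingStep (X? ∘ Nodes.to) (scS (Nodes.from x) (Nodes.from y))
           (subst X (sym (Nodes.strictlyInverseˡ x)) Xx) (¬Xy ∘ subst X (Nodes.strictlyInverseˡ y))
  ... | _ , _ , (i , i∈ , refl , refl) , X-src , ¬X-tgt =
    Links.to i , subst (_∈ S) (sym (Links.strictlyInverseʳ i)) i∈ ,
    subst X (Nodes.strictlyInverseˡ _) X-src , ¬X-tgt ∘ subst X (sym (Nodes.strictlyInverseˡ _))

  scE′ : SCSS G E′
  scE′ = walks⇒SCSS {P = λ e → ∃[ l ] e ≡ inj₁ l} (λ { (l , refl) → local∈E′ l }) (r , true)
    (λ (x , h) → hub x h ◅◅ inward x) (λ (x , h) → outward x ◅◅ hub⁻ x h)
    where
    W = Walk (λ e → ∃[ l ] e ≡ inj₁ l)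
    along : ∀ l → W (source (inj₁ l)) (target (inj₁ l))
    along l = (inj₁ l , (l , refl) , refl , refl) ◅ ε
    hub : ∀ x h → W (x , h) (x , true)
    hub x true  = ε
    hub x false = along (inj₁ (x , false))
    hub⁻ : ∀ x h → W (x , true) (x , h)
    hub⁻ x true  = ε
    hub⁻ x false = along (inj₁ (x , true))
    inward : ∀ x → W (x , true) (r , true)
    inward r     = ε
    inward (a j) = along (inj₂ (suc zero , j)) ◅◅ inward (b j)
    inward (b j) = along (inj₂ (suc (suc zero) , j))
    outward : ∀ x → W (r , true) (x , true)
    outward r     = ε
    outward (a j) = along (inj₂ (zero , j))
    outward (b j) = outward (a j) ◅◅ along (inj₂ (suc zero , j))

  scH : SCSS G H
  scH = walks⇒SCSS {P = λ e → ∃[ x ] e ≡ ham x} (λ { (x , refl) → ham∈H x }) (r , true) to-root from-root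
    where
    W = Walk (λ e → ∃[ x ] e ≡ ham x)
    along : ∀ x h → W (θ x , h) (x , not h)
    along x true  = (ham (x , false) , (_ , refl) , refl , refl) ◅ ε
    along x false = (ham (x , true) , (_ , refl) , refl , refl) ◅ ε
    -- Two edges return to the same level, hub or leaf. A full round has oddly many edges and
    -- switches the level, so two rounds meet every node.
    along² : ∀ x h → W (θ (θ x) , h) (x , h)
    along² x true  = along (θ x) true ◅◅ along x false
    along² x false = along (θ x) false ◅◅ along x true
    r⇒a : ∀ h i → W (r , h) (a i , h)
    r⇒a h = <-weakInduction (λ i → W (r , h) (a i , h)) (along² (a zero) h) (λ i w → w ◅◅ along² (a (suc i)) h)
    a⇒r : ∀ h i → W (a i , h) (r , not h)
    a⇒r h = >-weakInduction (λ i → W (a i , h) (r , not h)) (along r h) (λ i w → along² (a (suc i)) h ◅◅ w)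
    flip : ∀ h → W (r , h) (r , not h)
    flip h = r⇒a h zero ◅◅ a⇒r h zero
    ⇒r : ∀ h → W (r , h) (r , true)
    ⇒r true  = ε
    ⇒r false = flip false
    r⇒ : ∀ h → W (r , true) (r , h)
    r⇒ true  = ε
    r⇒ false = flip true
    to-root : ∀ x → W x (r , true)
    to-root (r , h)   = ⇒r h
    to-root (a i , h) = a⇒r h i ◅◅ ⇒r (not h)
    to-root (b i , h) = along (a i) h ◅◅ a⇒r (not h) i ◅◅ ⇒r (not (not h))
    from-root : ∀ x → W (r , true) x
    from-root (r , h)   = r⇒ h
    from-root (a i , h) = r⇒ h ◅◅ r⇒a h i
    from-root (b zero , true)  = flip true ◅◅ along (b zero) false
    from-root (b zero , false) = along (b zero) true
    from-root (b (suc i) , true)  = r⇒ false ◅◅ r⇒a false (inject₁ i) ◅◅ along (b (suc i)) false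
    from-root (b (suc i) , false) = r⇒a true (inject₁ i) ◅◅ along (b (suc i)) true

  root≢leaf : Nodes.from (r , true) ≢ Nodes.from (r , false)
  root≢leaf eq with () ← Injection.injective (↔⇒↣ (↔-sym nodes)) {r , true} {r , false} eq

  isOPT : IsOPT G #nodes
  isOPT = (H , scH , ∣H∣) , λ S scS → #V≤∣SCSS∣ G scS _ _ root≢leaf

  -- Local optimality of `E′` in the tight instance.

  -- The position of a bush around triangle j, everything not at a_j or
  -- b_j being on the side of the root.
  φ : Fin t → Bush → Fin 3
  φ j r = zero
  φ j (a i) with i Fin.≟ j
  ... | yes _ = suc zero
  ... | no  _ = zero
  φ j (b i) with i Fin.≟ j
  ... | yes _ = suc (suc zero)
  ... | no  _ = zero

  φ-corner : ∀ k j → φ j (corner k j) ≡ k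
  φ-corner zero _ = refl
  φ-corner (suc zero) j with j Fin.≟ j
  ... | yes _  = refl
  ... | no j≢j = contradiction refl j≢j
  φ-corner (suc (suc zero)) j with j Fin.≟ j
  ... | yes _  = refl
  ... | no j≢j = contradiction refl j≢j

  φ-off : ∀ {i j} → i ≢ j → ∀ k → φ j (corner k i) ≡ zero
  φ-off i≢j zero = refl
  φ-off {i} {j} i≢j (suc zero) with i Fin.≟ j
  ... | yes i≡j = contradiction i≡j i≢j
  ... | no  _   = refl
  φ-off {i} {j} i≢j (suc (suc zero)) with i Fin.≟ j
  ... | yes i≡j = contradiction i≡j i≢j
  ... | no  _   = refl

  -- Around triangle `j` the Hamiltonian cycle changes position only from 0 to 2, from 2 to 1 and
  -- from 1 to 0, against the direction of the triangle.
  ham-never-forward : ∀ j x → φ j x ≢ next (φ j (θ x))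
  ham-never-forward j r with Fin.fromℕ s Fin.≟ j
  ... | yes _ = λ ()
  ... | no  _ = λ ()
  ham-never-forward j (a i) with i Fin.≟ j
  ... | yes _ = λ ()
  ... | no  _ = λ ()
  ham-never-forward j (b zero) with zero Fin.≟ j
  ... | yes _ = λ ()
  ... | no  _ = λ ()
  ham-never-forward j (b (suc i)) with suc i Fin.≟ j | inject₁ i Fin.≟ j
  ... | yes eq | yes eq′ = contradiction (cong Fin.toℕ (trans eq (sym eq′)))
                             (λ e → ℕ.1+n≢n (trans e (Fin.toℕ-inject₁ i)))
  ... | yes _  | no  _ = λ ()
  ... | no  _  | yes _ = λ ()
  ... | no  _  | no  _ = λ ()

  φ-changes : ∀ {j} l → φ j (proj₁ (source (inj₁ l))) ≢ φ j (proj₁ (target (inj₁ l))) → ∃[ k ] l ≡ inj₂ (k , j)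
  φ-changes (inj₁ x) changes = contradiction refl changes
  φ-changes {j} (inj₂ (k , i)) changes with i Fin.≟ j
  ... | yes refl = k , refl
  ... | no  i≢j  = contradiction (trans (φ-off i≢j k) (sym (φ-off i≢j (next k)))) changes

  next-injective : ∀ {k k′} → next k ≡ next k′ → k ≡ k′
  next-injective {zero}           {zero}           _ = refl
  next-injective {suc zero}       {suc zero}       _ = refl
  next-injective {suc (suc zero)} {suc (suc zero)} _ = refl
  next-injective {zero}           {suc zero}       ()
  next-injective {zero}           {suc (suc zero)} ()
  next-injective {suc zero}       {zero}           ()
  next-injective {suc zero}       {suc (suc zero)} ()
  next-injective {suc (suc zero)} {zero}           ()
  next-injective {suc (suc zero)} {suc zero}       ()

  -- The only edge of E′ that can become redundant when e is added.
  rival : Link → Link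
  rival (inj₁ l)        = inj₁ l
  rival (ham (x , false)) = bush (x , true)
  rival (ham (x , true))  = bush (θ x , false)

  module _ {S : EdgeSet G} (scS : SCSS G S) (e : Link)
           (S⊆ : ∀ g → Links.from g ∈ S → g ≡ e ⊎ ∃[ l ] g ≡ inj₁ l)
           (l : Local) (l≢rival : inj₁ l ≢ rival e) (missing : Links.from (inj₁ l) ∉ S) where

    present : ∀ g → Links.from g ∈ S → (∃[ x ] (g ≡ ham x × e ≡ ham x)) ⊎ ∃[ l′ ] (g ≡ inj₁ l′ × l′ ≢ l)
    present (inj₁ l′) g∈ = inj₂ (l′ , refl , λ { refl → missing g∈ })
    present (ham x)   g∈ with S⊆ (ham x) g∈
    ... | inj₁ refl = inj₁ (x , refl , refl)

    -- The edge from the hub is the only one of `E′` into the leaf, and it is the rival of the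
    -- Hamiltonian edge into that leaf.
    enters : ∀ {x} → l ≡ inj₁ (x , true) → ∀ g → Links.from g ∈ S → target g ≢ (x , false)
    enters refl g g∈ t≡ with present g g∈ | t≡
    ... | inj₁ (x , refl , refl) | refl = l≢rival refl
    ... | inj₂ (inj₁ (y , true) , refl , ≢l) | refl = ≢l refl

    leaves : ∀ {x} → l ≡ inj₁ (x , false) → ∀ g → Links.from g ∈ S → source g ≢ (x , false)
    leaves refl g g∈ s≡ with present g g∈ | s≡
    ... | inj₁ ((y , true) , refl , refl) | refl = l≢rival refl
    ... | inj₂ (inj₁ (y , false) , refl , ≢l) | refl = ≢l refl

    -- The only edge of S into the position after l, and the only one out
    -- of the position before l, is e, which would go forward.
    around : ∀ {k j} → l ≢ inj₂ (k , j)
    around {k} {j} refl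
      with cut scS (λ y → ¬? (φ j (proj₁ y) Fin.≟ next k)) {corner k j , true} {corner (next k) j , true}
             (λ eq → k≢next k (trans (sym (φ-corner k j)) eq)) (λ ¬eq → ¬eq (φ-corner (next k) j))
         | cut scS (λ y → φ j (proj₁ y) Fin.≟ k) {corner k j , true} {corner (next k) j , true}
             (φ-corner k j) (λ eq → k≢next k (trans (sym eq) (φ-corner (next k) j)))
      where
      k≢next : ∀ k → k ≢ next k
      k≢next zero ()
      k≢next (suc zero) ()
      k≢next (suc (suc zero)) ()
    ... | g₁ , g₁∈ , s₁≢ , t₁≡′ | g₂ , g₂∈ , s₂≡ , t₂≢
      with decidable-stable (φ j (proj₁ (target g₁)) Fin.≟ next k) t₁≡′
    ... | t₁≡ with present g₁ g₁∈ | present g₂ g₂∈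
    ...   | inj₂ (l′ , refl , ≢l) | _ with φ-changes {j} l′ (λ eq → s₁≢ (trans eq t₁≡))
    ...     | k′ , refl = ≢l (cong (λ k → inj₂ (k , j)) (next-injective (trans (sym (φ-corner (next k′) j)) t₁≡)))
    around {k} {j} refl | g₁ , g₁∈ , s₁≢ , t₁≡′ | g₂ , g₂∈ , s₂≡ , t₂≢
      | t₁≡ | inj₁ _ | inj₂ (l′ , refl , ≢l)
      with φ-changes {j} l′ (λ eq → t₂≢ (trans (sym eq) s₂≡))
    ... | k′ , refl = ≢l (cong (λ k → inj₂ (k , j)) (trans (sym (φ-corner k′ j)) s₂≡))
    around {k} {j} refl | g₁ , g₁∈ , s₁≢ , t₁≡′ | g₂ , g₂∈ , s₂≡ , t₂≢
      | t₁≡ | inj₁ (x , refl , refl) | inj₁ (.x , refl , refl) =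
      ham-never-forward j (proj₁ x) (trans t₁≡ (cong next (sym s₂≡)))

    -- Each edge of `E′` is needed to enter a leaf, to leave a leaf, or to go around a triangle.
    -- Quantifying over `l′` permits the case split on the parameter `l`.
    local-needed : ∀ l′ → l ≢ l′
    local-needed (inj₁ (x , true)) l≡
      with cut scS (λ y → ¬? (y ≟ⁿ (x , false))) {x , true} {x , false} (λ ()) (λ ¬eq → ¬eq refl)
    ... | g , g∈ , _ , ¬¬t≡ = enters l≡ g g∈ (decidable-stable (target g ≟ⁿ (x , false)) ¬¬t≡)
    local-needed (inj₁ (x , false)) l≡
      with cut scS (λ y → y ≟ⁿ (x , false)) {x , false} {x , true} refl (λ ())
    ... | g , g∈ , s≡ , _ = leaves l≡ g g∈ s≡
    local-needed (inj₂ _) l≡ = around l≡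

  -- One of the two edges of `E₂` is not the rival of `e`, and its removal cannot be repaired by
  -- `e`.
  noExchange : ∀ {E₂ E₁} → E₂ ⊆ E′ → ∣ E₂ ∣ ≡ 2 → SCSS G ((E′ ─ E₂) ∪ E₁) →
               ∀ e → ¬ (∀ {x} → x ∈ E₁ → x ≡ Links.from e)
  noExchange {E₂} {E₁} E₂⊆E′ ∣E₂∣≡2 sc e E₁⊆e
    with another∈ (ℕ.≤-reflexive (sym ∣E₂∣≡2)) (Links.from (rival e))
  ... | i , i∈E₂ , i≢rival with ∈E′⇒local (E₂⊆E′ i∈E₂)
  ... | l , refl = local-needed sc e S⊆ l (i≢rival ∘ cong Links.from) missing l refl
    where
    link-injective : ∀ {g g′} → Links.from g ≡ Links.from g′ → g ≡ g′
    link-injective = Injection.injective (↔⇒↣ (↔-sym links))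

    S⊆ : ∀ g → Links.from g ∈ (E′ ─ E₂) ∪ E₁ → g ≡ e ⊎ ∃[ l ] g ≡ inj₁ l
    S⊆ g g∈ with x∈p∪q⁻ (E′ ─ E₂) E₁ g∈
    ... | inj₂ g∈E₁ = inj₁ (link-injective (E₁⊆e g∈E₁))
    ... | inj₁ g∈E′ with ∈E′⇒local (p─q⊆p E′ E₂ g∈E′)
    ...   | l′ , eq = inj₂ (l′ , link-injective eq)

    l≢e : ∀ e′ → inj₁ l ≢ rival e′ → inj₁ l ≢ e′
    l≢e (inj₁ l′) ≢rival = ≢rival

    missing : Links.from (inj₁ l) ∉ (E′ ─ E₂) ∪ E₁
    missing l∈ with x∈p∪q⁻ (E′ ─ E₂) E₁ l∈
    ... | inj₁ l∈E′ = x∈p─q⇒x∉q E′ E₂ l∈E′ i∈E₂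
    ... | inj₂ l∈E₁ = l≢e e (i≢rival ∘ cong Links.from) (link-injective (E₁⊆e l∈E₁))

  noStep : ∀ E″ → ¬ Step G E′ E″
  noStep _ (E₂ , E₁ , E₂⊆E′ , ∣E₂∣≡2 , ∣E₁∣≤1 , refl , sc) with nonempty? E₁
  -- With `E₁` empty, any link can serve as `e`.
  ... | no empty     = noExchange E₂⊆E′ ∣E₂∣≡2 sc (bush (r , true)) λ x∈ → contradiction (_ , x∈) empty
  ... | yes (i , i∈) = noExchange E₂⊆E′ ∣E₂∣≡2 sc (Links.to i) λ x∈ →
                         trans (∣p∣≤1⇒≡ ∣E₁∣≤1 x∈ i∈) (sym (Links.strictlyInverseʳ i))

  returns : 2-Exchange-Returns G E′
  returns = reachable G scE′ (_ , local∈E′ (inj₁ (r , true))) ⊆⊤ , noStep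

  stronglyConnected : StronglyConnected G
  stronglyConnected u v = Star.map (λ (e , _ , uv) → e , ∈⊤ , uv) (scE′ u v)

-- Clearing denominators.

↧-scaled : ∀ c k → ℚᵘ.↧ (toℚᵘ c ℚᵘ.* mkℚᵘ (+ k) 0) ≡ ↧ c
↧-scaled (ℚ.mkℚ _ d-1 _) k = cong +_ (ℕ.*-identityʳ (suc d-1))

↥-scaled : ∀ c k → ℚᵘ.↥ (toℚᵘ c ℚᵘ.* mkℚᵘ (+ k) 0) ≡ ↥ c ℤ.* + k
↥-scaled (ℚ.mkℚ _ _ _) k = refl

module _ (c : ℚ) (m k : ℕ) where

  private
    c*k≃ : toℚᵘ (c ℚ.* fromℕ k) ℚᵘ.≃ toℚᵘ c ℚᵘ.* mkℚᵘ (+ k) 0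
    c*k≃ = ℚᵘ.≃-trans (ℚ.toℚᵘ-homo-* c (fromℕ k)) (ℚᵘ.*-congˡ {toℚᵘ c} (ℚ.toℚᵘ-fromℚᵘ (mkℚᵘ (+ k) 0)))

    m≃ : toℚᵘ (fromℕ m) ℚᵘ.≃ mkℚᵘ (+ m) 0
    m≃ = ℚ.toℚᵘ-fromℚᵘ (mkℚᵘ (+ m) 0)

    lhs : + m ℤ.* ℚᵘ.↧ (toℚᵘ c ℚᵘ.* mkℚᵘ (+ k) 0) ≡ + m ℤ.* ↧ c
    lhs = cong (+ m ℤ.*_) (↧-scaled c k)

    rhs : ℚᵘ.↥ (toℚᵘ c ℚᵘ.* mkℚᵘ (+ k) 0) ℤ.* + 1 ≡ ↥ c ℤ.* + k
    rhs = trans (ℤ.*-identityʳ _) (↥-scaled c k)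

  ratio⁺ : + m ℤ.* ↧ c ℤ.≤ ↥ c ℤ.* + k → fromℕ m ℚ.≤ c ℚ.* fromℕ k
  ratio⁺ le = ℚ.toℚᵘ-cancel-≤ (ℚᵘ.≤-respˡ-≃ (ℚᵘ.≃-sym m≃) (ℚᵘ.≤-respʳ-≃ (ℚᵘ.≃-sym c*k≃)
    (*≤* (subst₂ ℤ._≤_ (sym lhs) (sym rhs) le))))

  ratio⁻ : fromℕ m ℚ.≤ c ℚ.* fromℕ k → + m ℤ.* ↧ c ℤ.≤ ↥ c ℤ.* + k
  ratio⁻ le = subst₂ ℤ._≤_ lhs rhs
    (ℚᵘ.drop-*≤* (ℚᵘ.≤-respˡ-≃ m≃ (ℚᵘ.≤-respʳ-≃ c*k≃ (ℚ.toℚᵘ-mono-≤ le))))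

-- The bound and its tightness.

2-exchange-output-SCSS : ∀ (G : Digraph) → StronglyConnected G → ∀ {E′} → Star (Step G) ⊤ E′ → SCSS G E′
2-exchange-output-SCSS G sc = go sc
  where
  go : ∀ {S T} → SCSS G S → Star (Step G) S T → SCSS G T
  go scS ε = scS
  go _ ((_ , _ , _ , _ , _ , _ , scS′) ◅ steps) = go scS′ steps

ratio≤7/4 : 2-Exchange-Ratio≤ (+ 7 / 4)
ratio≤7/4 G sc E′ (steps , noStep) k ((S , scS , refl) , _) = ratio⁺ (+ 7 / 4) ∣ E′ ∣ ∣ S ∣
  (subst₂ ℤ._≤_ (trans (cong +_ (ℕ.*-comm 4 ∣ E′ ∣)) (ℤ.pos-* ∣ E′ ∣ 4)) (ℤ.pos-* 7 ∣ S ∣) (ℤ.+≤+ bound))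
  where
  bound : 4 ℕ.* ∣ E′ ∣ ≤ 7 ℕ.* ∣ S ∣
  bound = LocalOptimum.2-exchange-bound G E′ (2-exchange-output-SCSS G sc steps) noStep scS

7/4-tight : ∀ (c : ℚ) → c < + 7 / 4 → ¬ 2-Exchange-Ratio≤ c
7/4-tight c c<7/4 ratio = ℕ.<⇒≱ too-big (ℤ.drop‿+≤+ combined)
  where
  p = ↥ c
  d = ↧ₙ c
  -- Since `4 * #local` is `7 * #nodes` minus 6, the inequality to refute amounts to 4t + 2 ≤ 6d,
  -- which fails for t = 2d + 1.
  open Tight (2 ℕ.* d)

  p<7d/4 : p ℤ.* + 4 ℤ.< + 7 ℤ.* + d
  p<7d/4 = ℚ.drop-*<* c<7/4

  output : + #local ℤ.* + d ℤ.≤ p ℤ.* + #nodes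
  output = ratio⁻ c #local #nodes (subst (λ m → fromℕ m ℚ.≤ c ℚ.* fromℕ #nodes) ∣E′∣
    (ratio G stronglyConnected E′ returns #nodes isOPT))

  -- Over the integers `p<7d/4` gains a unit, which becomes the summand `#nodes`.
  combined : + (4 ℕ.* (#local ℕ.* d) ℕ.+ #nodes) ℤ.≤ + (7 ℕ.* d ℕ.* #nodes)
  combined = begin
    + (4 ℕ.* (#local ℕ.* d) ℕ.+ #nodes)          ≡⟨ cong (ℤ._+ + #nodes)
      (trans (ℤ.pos-* 4 (#local ℕ.* d)) (cong (+ 4 ℤ.*_) (ℤ.pos-* #local d))) ⟩
    + 4 ℤ.* (+ #local ℤ.* + d) ℤ.+ + #nodes      ≤⟨ ℤ.+-monoˡ-≤ (+ #nodes) (ℤ.*-monoˡ-≤-nonNeg (+ 4) output) ⟩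
    + 4 ℤ.* (p ℤ.* + #nodes) ℤ.+ + #nodes        ≡⟨ factor p (+ #nodes) ⟩
    ℤ.suc (p ℤ.* + 4) ℤ.* + #nodes               ≤⟨ ℤ.*-monoʳ-≤-nonNeg (+ #nodes) (ℤ.i<j⇒suc[i]≤j p<7d/4) ⟩
    + 7 ℤ.* + d ℤ.* + #nodes                     ≡⟨ trans
      (cong (ℤ._* + #nodes) (sym (ℤ.pos-* 7 d))) (sym (ℤ.pos-* (7 ℕ.* d) #nodes)) ⟩
    + (7 ℕ.* d ℕ.* #nodes)                       ∎
    where
    open ℤ.≤-Reasoning
    factor : ∀ p n → + 4 ℤ.* (p ℤ.* n) ℤ.+ n ≡ (+ 1 ℤ.+ p ℤ.* + 4) ℤ.* n
    factor = ℤ.solve-∀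

  too-big : 7 ℕ.* d ℕ.* #nodes ℕ.< 4 ℕ.* (#local ℕ.* d) ℕ.+ #nodes
  too-big = ℕ.≤-trans (ℕ.m≤m+n _ (2 ℕ.* d ℕ.+ 5)) (ℕ.≤-reflexive (surplus d))
    where
    surplus : ∀ d → let n = (1 ℕ.+ (suc (2 ℕ.* d) ℕ.+ suc (2 ℕ.* d))) ℕ.* 2 in
      suc (7 ℕ.* d ℕ.* n) ℕ.+ (2 ℕ.* d ℕ.+ 5) ≡ 4 ℕ.* ((n ℕ.+ 3 ℕ.* suc (2 ℕ.* d)) ℕ.* d) ℕ.+ n
    surplus = solve-∀

theorem5p1 : 2-Exchange-Ratio≤ (+ 7 / 4) × (∀ (c : ℚ) → c < + 7 / 4 → ¬ 2-Exchange-Ratio≤ c)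
theorem5p1 = ratio≤7/4 , 7/4-tight
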